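{- Let $w = (w_1, \dots, w_{52})$ be the word in which each of the letters $1, 2, \dots, 13$ appears exactly $4$ times, arranged in weakly increasing order, i.e. $w_j = \lceil j/4 \rceil$ for $1 \le j \le 52$. The number of words $u = (u_1, \dots, u_{52})$ that are rearrangements of $w$ (i.e. each of the letters $1, \dots, 13$ appears exactly $4$ times in $u$) and satisfy $u_j \neq w_j$ for every $j \in \{1, \dots, 52\}$ is exactly $$1493804444499093354916284290188948031229880469556.$$
   Context: This counts the derangements of a standard deck of $52$ cards when suits are ignored: there are $13$ denominations, each occurring $4$ times, and cards of the same denomination are regarded as identical. In general, a derangement of the multiset $1^{a_1} \cdots n^{a_n}$ (with $a_i$ copies of $i$) is an arrangement of the multiset, among the $(a_1+\dots+a_n)!/(a_1!\cdots a_n!)$ distinct arrangements, which at every location differs from the original arrangement $1^{a_1} 2^{a_2}\cdots n^{a_n}$; the number of these is denoted $M(a_1, \dots, a_n)$. The number in the claim is $M(4,4,\dots,4)$ with $4$ repeated $13$ times. -}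

module Defs where

open import Data.Fin.Base using (Fin; quotient)
open import Data.Fin.Properties using (_≟_)
open import Data.Product.Base using (_×_)
open import Data.Refinement.Base using (Refinement-syntax)
open import Data.Vec.Base using (Vec; tabulate; lookup; count)
open import Relation.Binary.PropositionalEquality.Core using (_≡_; _≢_)

-- Letters and positions are numbered from 0: a : Fin 13 is the letter
-- toℕ a + 1, and j : Fin 52 is the position toℕ j + 1.
Letter : Set
Letter = Fin 13

Word : Set
Word = Vec Letter 52

-- ⌈ (j + 1) / 4 ⌉ = ⌊ j / 4 ⌋ + 1, so in the 0-based numbering the letter
-- at j is the quotient of j by 4.
w : Word
w = tabulate (quotient {13} 4)

-- w itself contains every letter exactly 4 times, so these are the
-- rearrangements of w.
IsRearrangement : Word → Set
IsRearrangement u = ∀ (a : Letter) → count (a ≟_) u ≡ 4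

IsDerangement : Word → Set
IsDerangement u = IsRearrangement u × (∀ (j : Fin 52) → lookup u j ≢ lookup w j)

-- The proof component of a refinement is irrelevant, so an element is
-- determined by its word, and counting elements counts words.
Derangement : Set
Derangement = [ u ∈ Word ∣ IsDerangement u ]

{-# OPTIONS --safe #-}
-- The arrangements of a multiset satisfy a recurrence that reads off their
-- first letter.  The inclusion–exclusion sum over the positions holding their
-- forbidden letter satisfies it too, because removing one forbidden position
-- is a backward difference in the multiplicity of a letter, and each term is a
-- multinomial coefficient, to which Pascal's rule applies.  Splitting the
-- multinomial coefficients into binomial ones evaluates the sum one letter at
-- a time, the only state being the number of places taken so far.
module Submission where

open import Algebra.Properties.CommutativeMonoid.Sum as MonoidSum using ()
open import Algebra.Properties.Semiring.Sum as SemiringSum using ()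
open import Data.Bool.Base using (true; false; if_then_else_)
open import Data.Empty using (⊥-elim-irr)
open import Data.Fin.Base using (Fin; zero; suc)
open import Data.Fin.Properties using (_≟_; +↔⊎)
open import Data.Integer.Base using (ℤ; +_; 0ℤ; 1ℤ; ∣_∣; _+_; _*_; _-_)
open import Data.Integer.Properties as ℤ using ()
open import Data.Integer.Tactic.RingSolver using (solve-∀)
open import Data.Irrelevant using ([_])
open import Data.List.Base using (List; []; _∷_; applyUpTo)
open import Data.Maybe.Base as Maybe using (Maybe; just; nothing; maybe′)
open import Data.Nat.Base as ℕ using (ℕ; zero; suc; _<_; s<s⁻¹)
open import Data.Nat.Combinatorics using (_C_; nCn≡1; nCk+nC[k+1]≡[n+1]C[k+1])
open import Data.Nat.Properties as ℕ using ()
open import Data.Product.Base using (Σ; _×_; _,_; proj₁; proj₂)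
open import Data.Refinement.Base using (Refinement-syntax; refine; _,_)
open import Data.Sum.Base using (_⊎_; inj₁; inj₂)
open import Data.Sum.Function.Propositional using (_⊎-↔_)
open import Data.Vec.Base using (Vec; []; _∷_; count; foldr′; lookup; replicate; sum; _[_]%=_)
open import Data.Vec.Properties using (lookup-replicate)
open import Function.Base using (_∘_; id)
open import Function.Bundles using (_↔_; mk↔ₛ′)
open import Function.Construct.Composition using (_↔-∘_)
open import Function.Construct.Symmetry using (↔-sym)
open import Relation.Binary.PropositionalEquality
open import Relation.Nullary using (¬_; does; yes; no)
open import Defs

open SemiringSum ℤ.+-*-semiring using (*-distribˡ-sum; sum-cong-≗)
  renaming (sum to ∑ℤ)
open MonoidSum ℕ.+-0-commutativeMonoid using () renaming (sum to ∑ℕ)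

private
  variable
    k n : ℕ

-- Removing a letter from a multiset

remove : Fin k → Vec ℕ k → Maybe (Vec ℕ k)
remove zero    (zero  ∷ c) = nothing
remove zero    (suc x ∷ c) = just (x ∷ c)
remove (suc a) (x     ∷ c) = Maybe.map (x ∷_) (remove a c)

remove-sum : ∀ (a : Fin k) c {c′} → remove a c ≡ just c′ → sum c ≡ suc (sum c′)
remove-sum zero    (suc x ∷ c) refl = refl
remove-sum (suc a) (x ∷ c) eq with remove a c in eq′
remove-sum (suc a) (x ∷ c) refl | just c′ =
  trans (cong (x ℕ.+_) (remove-sum a c eq′)) (ℕ.+-suc x (sum c′))

remove-nothing : ∀ (a : Fin k) c → remove a c ≡ nothing → lookup c a ≡ 0
remove-nothing zero    (zero ∷ c) eq = refl
remove-nothing (suc a) (x ∷ c) eq with remove a c in eq′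
... | nothing = remove-nothing a c eq′

-- The `if` form is the one to which `count` unfolds at a first letter `a`, so the two can be
-- cancelled against each other.
lookup-remove : ∀ (a : Fin k) c {c′} → remove a c ≡ just c′ → ∀ x →
                lookup c x ≡ (if does (x ≟ a) then suc else id) (lookup c′ x)
lookup-remove zero    (suc y ∷ c) refl zero    = refl
lookup-remove zero    (suc y ∷ c) refl (suc x) = refl
lookup-remove (suc a) (y ∷ c) eq x with remove a c in eq′
lookup-remove (suc a) (y ∷ c) refl zero    | just c′ = refl
lookup-remove (suc a) (y ∷ c) refl (suc x) | just c′ = lookup-remove a c eq′ x

-- Counting arrangements by their first letter

arrangements : Vec (Fin k) n → Vec ℕ k → ℕ
-- The value 1 is correct only when `c` is empty, which `n ≡ sum c` guarantees in the lemmas that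
-- use it.
arrangements []      c = 1
arrangements (b ∷ p) c = ∑ℕ λ a →
  if does (a ≟ b) then 0 else maybe′ (arrangements p) 0 (remove a c)

IsArrangement : Vec (Fin k) n → Vec ℕ k → Vec (Fin k) n → Set
IsArrangement p c u =
  (∀ a → count (a ≟_) u ≡ lookup c a) × (∀ j → lookup u j ≢ lookup p j)

-- Irrelevance of the proof component makes both round trips definitional.
refine-↔ : ∀ {A : Set} {P Q : A → Set} → (∀ {x} → P x → Q x) → (∀ {x} → Q x → P x) →
           [ x ∈ A ∣ P x ] ↔ [ x ∈ A ∣ Q x ]
refine-↔ f g = mk↔ₛ′ (refine f) (refine g) (λ _ → refl) (λ _ → refl)

empty-↔ : ∀ {A : Set} {P : A → Set} → (∀ x → ¬ P x) → [ x ∈ A ∣ P x ] ↔ Fin 0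
empty-↔ ¬P = mk↔ₛ′ (λ { (x , [ p ]) → ⊥-elim-irr (¬P x p) }) (λ ()) (λ ())
  (λ { (x , [ p ]) → ⊥-elim-irr (¬P x p) })

uncons-↔ : ∀ {A : Set} {P : Vec A (suc n) → Set} →
           [ u ∈ Vec A (suc n) ∣ P u ] ↔ Σ A λ a → [ v ∈ Vec A n ∣ P (a ∷ v) ]
uncons-↔ = mk↔ₛ′ (λ { (a ∷ v , p) → a , (v , p) }) (λ { (a , (v , p)) → a ∷ v , p })
  (λ _ → refl) (λ { (a ∷ v , p) → refl })

Σ-suc-↔ : ∀ {X : Fin (suc k) → Set} → Σ (Fin (suc k)) X ↔ (X zero ⊎ Σ (Fin k) (X ∘ suc))
Σ-suc-↔ = mk↔ₛ′
  (λ { (zero , x) → inj₁ x ; (suc a , x) → inj₂ (a , x) })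
  (λ { (inj₁ x) → zero , x ; (inj₂ (a , x)) → suc a , x })
  (λ { (inj₁ x) → refl ; (inj₂ _) → refl })
  (λ { (zero , x) → refl ; (suc a , x) → refl })

Σ-Fin-↔ : ∀ {X : Fin k → Set} {f : Fin k → ℕ} → (∀ a → X a ↔ Fin (f a)) →
          Σ (Fin k) X ↔ Fin (∑ℕ f)
Σ-Fin-↔ {zero}  h = mk↔ₛ′ (λ ()) (λ ()) (λ ()) (λ ())
Σ-Fin-↔ {suc k} h = ↔-sym +↔⊎ ↔-∘ ((h zero ⊎-↔ Σ-Fin-↔ (h ∘ suc)) ↔-∘ Σ-suc-↔)

suc-if-injective : ∀ d {x y : ℕ} → (if d then suc else id) x ≡ (if d then suc else id) y → x ≡ y
suc-if-injective false eq = eq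
suc-if-injective true  eq = ℕ.suc-injective eq

lookup≤sum : ∀ (c : Vec ℕ k) a → lookup c a ℕ.≤ sum c
lookup≤sum (x ∷ c) zero    = ℕ.m≤m+n x (sum c)
lookup≤sum (x ∷ c) (suc a) = ℕ.≤-trans (lookup≤sum c a) (ℕ.m≤n+m (sum c) x)

count-head : ∀ (a : Fin k) (v : Vec (Fin k) n) → count (a ≟_) (a ∷ v) ≢ 0
count-head a v eq with a ≟ a
count-head a v () | yes _
... | no a≢a = a≢a refl

-- A word starting with `a` qualifies exactly when `a` differs from `b`, `c` contains `a`, and the
-- tail qualifies for `p` and `c` without that copy.
arrangements-↔ : ∀ (p : Vec (Fin k) n) c → n ≡ sum c →
                 [ u ∈ Vec (Fin k) n ∣ IsArrangement p c u ] ↔ Fin (arrangements p c)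
arrangements-↔ [] c 0≡sum = mk↔ₛ′ (λ _ → zero)
  (λ _ → [] , [ (λ a → sym (ℕ.n≤0⇒n≡0 (subst (lookup c a ℕ.≤_) (sym 0≡sum) (lookup≤sum c a)))) , (λ ()) ])
  (λ { zero → refl }) (λ { ([] , _) → refl })
arrangements-↔ {k} {suc n} (b ∷ p) c n≡sum = Σ-Fin-↔ tails ↔-∘ uncons-↔
  where
  tails : ∀ a → [ v ∈ Vec (Fin k) n ∣ IsArrangement (b ∷ p) c (a ∷ v) ] ↔
                Fin (if does (a ≟ b) then 0 else maybe′ (arrangements p) 0 (remove a c))
  tails a with a ≟ b
  ... | yes a≡b = empty-↔ λ v P → proj₂ P zero a≡b
  ... | no  a≢b with remove a c in eq
  ...   | nothing = empty-↔ λ v P → count-head a v (trans (proj₁ P a) (remove-nothing a c eq))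
  ...   | just c′ =
    arrangements-↔ p c′ (ℕ.suc-injective (trans n≡sum (remove-sum a c eq))) ↔-∘
    refine-↔
      (λ P → (λ x → suc-if-injective (does (x ≟ a)) (trans (proj₁ P x) (lookup-remove a c eq x)))
           , (λ j → proj₂ P (suc j)))
      (λ P → (λ x → trans (cong (if does (x ≟ a) then suc else id) (proj₁ P x))
                          (sym (lookup-remove a c eq x)))
           , (λ { zero → a≢b ; (suc j) → proj₂ P j }))

-- Lowering one argument of a function, and backward differences

lower : (ℕ → ℤ) → ℕ → ℤ
lower f zero    = 0ℤ
lower f (suc x) = f x

lower-minus : ∀ f g x → lower (λ z → f z - g z) x ≡ lower f x - lower g x
lower-minus f g zero    = refl
lower-minus f g (suc x) = refl

∂ : Fin k → (Vec ℕ k → ℤ) → Vec ℕ k → ℤ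
∂ a f c = maybe′ f 0ℤ (remove a c)

∂-zero : ∀ (f : Vec ℕ (suc k) → ℤ) x c → ∂ zero f (x ∷ c) ≡ lower (λ z → f (z ∷ c)) x
∂-zero f zero    c = refl
∂-zero f (suc x) c = refl

∂-suc : ∀ (a : Fin k) f x c → ∂ (suc a) f (x ∷ c) ≡ ∂ a (λ c → f (x ∷ c)) c
∂-suc a f x c with remove a c
... | nothing = refl
... | just _  = refl

∂-minus : ∀ (a : Fin k) f g c → ∂ a (λ c → f c - g c) c ≡ ∂ a f c - ∂ a g c
∂-minus a f g c with remove a c
... | nothing = refl
... | just _  = refl

∂-scale : ∀ (a : Fin k) m f c → m * ∂ a f c ≡ ∂ a (λ c → m * f c) c
∂-scale a m f c with remove a c
... | nothing = ℤ.*-zeroʳ m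
... | just _  = refl

-- When `f` counts arrangements, this is the sum over the possible first letters.
∑∂ : (Vec ℕ k → ℤ) → Vec ℕ k → ℤ
∑∂ f c = ∑ℤ λ a → ∂ a f c

∑-minus : ∀ (f g : Fin k → ℤ) → ∑ℤ (λ a → f a - g a) ≡ ∑ℤ f - ∑ℤ g
∑-minus {zero}  f g = refl
∑-minus {suc k} f g =
  trans (cong (_+_ (f zero - g zero)) (∑-minus (f ∘ suc) (g ∘ suc)))
        (interchange (f zero) (g zero) (∑ℤ (f ∘ suc)) (∑ℤ (g ∘ suc)))
  where
  interchange : ∀ x y s t → x - y + (s - t) ≡ x + s - (y + t)
  interchange = solve-∀

∑∂-minus : ∀ (f g : Vec ℕ k → ℤ) c → ∑∂ (λ c → f c - g c) c ≡ ∑∂ f c - ∑∂ g c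
∑∂-minus f g c = trans (sum-cong-≗ λ a → ∂-minus a f g c)
                          (∑-minus (λ a → ∂ a f c) (λ a → ∂ a g c))

∑∂-scale : ∀ m (f : Vec ℕ k → ℤ) c → m * ∑∂ f c ≡ ∑∂ (λ c → m * f c) c
∑∂-scale m f c = trans (*-distribˡ-sum m λ a → ∂ a f c) (sum-cong-≗ λ a → ∂-scale a m f c)

∑∂-∷ : ∀ (f : Vec ℕ (suc k) → ℤ) x c →
       ∑∂ f (x ∷ c) ≡ lower (λ z → f (z ∷ c)) x + ∑∂ (λ c → f (x ∷ c)) c
∑∂-∷ f x c = cong₂ _+_ (∂-zero f x c) (sum-cong-≗ λ a → ∂-suc a f x c)

-- The power `(1 - lower)^y`, that is, the sum of `(-1)^i (y choose i) f (x - i)` over `i ≤ x`. The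
-- binomial counts the choices of `i` among `y` forbidden positions.
diff : ℕ → (ℕ → ℤ) → ℕ → ℤ
diff zero    f x       = f x
diff (suc y) f zero    = diff y f zero
diff (suc y) f (suc x) = diff y f (suc x) - diff y f x

diff-suc : ∀ y f x → diff (suc y) f x ≡ diff y f x - lower (diff y f) x
diff-suc y f zero    = sym (ℤ.+-identityʳ (diff y f zero))
diff-suc y f (suc x) = refl

diff-cong : ∀ y {f g : ℕ → ℤ} → f ≗ g → diff y f ≗ diff y g
diff-cong zero    f≗g x       = f≗g x
diff-cong (suc y) f≗g zero    = diff-cong y f≗g zero
diff-cong (suc y) f≗g (suc x) = cong₂ _-_ (diff-cong y f≗g (suc x)) (diff-cong y f≗g x)

diff-minus : ∀ y f g x → diff y (λ z → f z - g z) x ≡ diff y f x - diff y g x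
diff-minus zero    f g x       = refl
diff-minus (suc y) f g zero    = diff-minus y f g zero
diff-minus (suc y) f g (suc x) =
  trans (cong₂ _-_ (diff-minus y f g (suc x)) (diff-minus y f g x))
        (interchange (diff y f (suc x)) (diff y g (suc x)) (diff y f x) (diff y g x))
  where
  interchange : ∀ p q s t → p - q - (s - t) ≡ p - s - (q - t)
  interchange = solve-∀

diff-0 : ∀ y x → diff y (λ _ → 0ℤ) x ≡ 0ℤ
diff-0 zero    x       = refl
diff-0 (suc y) zero    = diff-0 y zero
diff-0 (suc y) (suc x) = cong₂ _-_ (diff-0 y (suc x)) (diff-0 y x)

diff-∂ : ∀ y (a : Fin k) (f : Vec ℕ k → ℕ → ℤ) c x →
         diff y (λ z → ∂ a (λ c → f c z) c) x ≡ ∂ a (λ c → diff y (f c) x) c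
diff-∂ y a f c x with remove a c
... | nothing = diff-0 y x
... | just _  = refl

-- The inclusion–exclusion sum

-- Among `t + x` indistinguishable objects, the binomial coefficient selects the `x` that become
-- copies of the next letter.
shuffle : (ℕ → ℤ) → ℕ → ℕ → ℤ
shuffle f t x = + ((t ℕ.+ x) C x) * f (t ℕ.+ x)

-- signed r c t counts, with sign (-1)^(Σ i), the choices of i_a of the r_a
-- positions at which the letter a is forbidden, together with an arrangement of
-- the remaining c_a - i_a copies of each a and t indistinguishable further objects.
signed : Vec ℕ k → Vec ℕ k → ℕ → ℤ
signed []      []      t = 1ℤ
signed (y ∷ r) (x ∷ c) t = diff y (shuffle (signed r c) t) x

-- The first of the `t + x` objects is either a copy of the letter or one of the other `t`.
shuffle-pascal : ∀ f t x → + ((t ℕ.+ x) C x) * lower f (t ℕ.+ x) ≡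
                           lower (shuffle f t) x + lower (λ t → shuffle f t x) t
shuffle-pascal f zero    zero    = refl
shuffle-pascal f (suc t) zero    = sym (ℤ.+-identityˡ (1ℤ * f (t ℕ.+ 0)))
shuffle-pascal f zero    (suc x)
  rewrite nCn≡1 (suc x) | nCn≡1 x = sym (ℤ.+-identityʳ (1ℤ * f x))
shuffle-pascal f (suc t) (suc x)
  rewrite ℕ.+-suc t x | sym (nCk+nC[k+1]≡[n+1]C[k+1] (suc (t ℕ.+ x)) x) =
  ℤ.*-distribʳ-+ (f (suc (t ℕ.+ x))) (+ (suc (t ℕ.+ x) C x)) (+ (suc (t ℕ.+ x) C suc x))

-- The hypothesis keeps every multiset arranged in the sum nonempty: the only
-- arrangement of the empty one has no first letter.
signed-first : ∀ (r c : Vec ℕ k) t → sum r < t ℕ.+ sum c →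
               signed r c t ≡ ∑∂ (λ c → signed r c t) c + lower (signed r c) t
signed-first []      []      (suc t) _ = refl
signed-first {suc k} (y ∷ r) (x ∷ c) t r<t+c =
  trans (head y x r<t+c) (cong (_+ lower (signed (y ∷ r) (x ∷ c)) t)
                             (sym (∑∂-∷ (λ c → signed (y ∷ r) c t) x c)))
  where
  open ≡-Reasoning

  φ : Vec ℕ k → ℕ → ℕ → ℤ
  φ c = shuffle (signed r c)

  regroup : ∀ a s l a′ s′ l′ → a′ + s + l - (a + s′ + l′) ≡ a′ - a + (s - s′) + (l - l′)
  regroup = solve-∀

  -- Induction on the number `y` of forbidden positions of the first letter, with its multiplicity
  -- `x` varying.
  head : ∀ y x → y ℕ.+ sum r < t ℕ.+ (x ℕ.+ sum c) →
         diff y (φ c t) x ≡ lower (diff y (φ c t)) x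
                            + ∑∂ (λ c → diff y (φ c t) x) c
                            + lower (λ t → diff y (φ c t) x) t
  head zero x r<t+x+c = begin
    m * signed r c (t ℕ.+ x)
      ≡⟨ cong (m *_) (signed-first r c (t ℕ.+ x) (subst (sum r <_) (sym (ℕ.+-assoc t x (sum c))) r<t+x+c)) ⟩
    m * (∑∂ (λ c → signed r c (t ℕ.+ x)) c + lower (signed r c) (t ℕ.+ x))
      ≡⟨ ℤ.*-distribˡ-+ m _ _ ⟩
    m * ∑∂ (λ c → signed r c (t ℕ.+ x)) c + m * lower (signed r c) (t ℕ.+ x)
      ≡⟨ cong₂ _+_ (∑∂-scale m (λ c → signed r c (t ℕ.+ x)) c) (shuffle-pascal (signed r c) t x) ⟩
    ∑∂ (λ c → φ c t x) c + (lower (φ c t) x + lower (λ t → φ c t x) t)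
      ≡⟨ swap (∑∂ (λ c → φ c t x) c) (lower (φ c t) x) (lower (λ t → φ c t x) t) ⟩
    lower (φ c t) x + ∑∂ (λ c → φ c t x) c + lower (λ t → φ c t x) t ∎
    where
    m : ℤ
    m = + ((t ℕ.+ x) C x)

    swap : ∀ s a l → s + (a + l) ≡ a + s + l
    swap = solve-∀
  -- At multiplicity 0 nothing is subtracted, so the orders `suc y` and `y` give the same identity.
  head (suc y) zero    r<t+c = head y zero (ℕ.<-trans (ℕ.n<1+n _) r<t+c)
  -- The identity at `x` is subtracted from that at `suc x`; at `x` the bound survives because both
  -- its sides drop by one.
  head (suc y) (suc x) r<t+c = begin
    D t (suc x) - D t x
      ≡⟨ cong₂ _-_ (head y (suc x) (ℕ.<-trans (ℕ.n<1+n _) r<t+c))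
                   (head y x (s<s⁻¹ (subst (suc y ℕ.+ sum r <_) (ℕ.+-suc t (x ℕ.+ sum c)) r<t+c))) ⟩
    D t x + ∑∂ (λ c → diff y (φ c t) (suc x)) c + lower (λ t → D t (suc x)) t
      - (lower (D t) x + ∑∂ (λ c → diff y (φ c t) x) c + lower (λ t → D t x) t)
      ≡⟨ regroup (lower (D t) x) _ _ (D t x) _ _ ⟩
    D t x - lower (D t) x
      + (∑∂ (λ c → diff y (φ c t) (suc x)) c - ∑∂ (λ c → diff y (φ c t) x) c)
      + (lower (λ t → D t (suc x)) t - lower (λ t → D t x) t)
      ≡⟨ cong₂ _+_ (cong₂ _+_ (sym (diff-suc y (φ c t) x))
                              (sym (∑∂-minus (λ c → diff y (φ c t) (suc x)) (λ c → diff y (φ c t) x) c)))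
                   (sym (lower-minus (λ t → D t (suc x)) (λ t → D t x) t)) ⟩
    diff (suc y) (φ c t) x
      + ∑∂ (λ c → diff (suc y) (φ c t) (suc x)) c
      + lower (λ t → diff (suc y) (φ c t) (suc x)) t ∎
    where
    D : ℕ → ℕ → ℤ
    D t = diff y (φ c t)

-- Adding a forbidden position

insert : Fin k → Vec ℕ k → Vec ℕ k
insert b r = r [ b ]%= suc

-- A new forbidden position of `b` is either not chosen, or chosen, which flips the sign and uses up
-- one copy of `b`.
signed-insert : ∀ (b : Fin k) r c t →
                signed (insert b r) c t ≡ signed r c t - ∂ b (λ c → signed r c t) c
signed-insert zero    (y ∷ r) (x ∷ c) t =
  trans (diff-suc y _ x)
        (cong (signed (y ∷ r) (x ∷ c) t -_) (sym (∂-zero (λ c → signed (y ∷ r) c t) x c)))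
signed-insert {suc k} (suc b) (y ∷ r) (x ∷ c) t = begin
  diff y (shuffle (signed (insert b r) c) t) x
    ≡⟨ diff-cong y expand x ⟩
  diff y (λ z → φ c z - ∂ b (λ c → φ c z) c) x
    ≡⟨ diff-minus y (φ c) (λ z → ∂ b (λ c → φ c z) c) x ⟩
  diff y (φ c) x - diff y (λ z → ∂ b (λ c → φ c z) c) x
    ≡⟨ cong (diff y (φ c) x -_) (diff-∂ y b φ c x) ⟩
  diff y (φ c) x - ∂ b (λ c → diff y (φ c) x) c
    ≡⟨ cong (diff y (φ c) x -_) (∂-suc b (λ c → signed (y ∷ r) c t) x c) ⟨
  signed (y ∷ r) (x ∷ c) t - ∂ (suc b) (λ c → signed (y ∷ r) c t) (x ∷ c) ∎
  where
  open ≡-Reasoning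

  φ : Vec ℕ k → ℕ → ℤ
  φ c = shuffle (signed r c) t

  distrib : ∀ m u v → m * (u - v) ≡ m * u - m * v
  distrib = solve-∀

  expand : ∀ z → shuffle (signed (insert b r) c) t z ≡ φ c z - ∂ b (λ c → φ c z) c
  expand z = let m = + ((t ℕ.+ z) C z) in
    trans (cong (m *_) (signed-insert b r c (t ℕ.+ z)))
          (trans (distrib m _ _)
                 (cong (φ c z -_) (∂-scale b m (λ c → signed r c (t ℕ.+ z)) c)))

multiplicities : Vec (Fin k) n → Vec ℕ k
multiplicities = foldr′ insert (replicate _ 0)

sum-insert : ∀ (b : Fin k) r → sum (insert b r) ≡ suc (sum r)
sum-insert zero    (y ∷ r) = refl
sum-insert (suc b) (y ∷ r) = trans (cong (y ℕ.+_) (sum-insert b r)) (ℕ.+-suc y (sum r))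

sum-zeros : ∀ k → sum (replicate k 0) ≡ 0
sum-zeros zero    = refl
sum-zeros (suc k) = sum-zeros k

sum-multiplicities : ∀ (p : Vec (Fin k) n) → sum (multiplicities p) ≡ n
sum-multiplicities {k} []  = sum-zeros k
sum-multiplicities (b ∷ p) = trans (sum-insert b (multiplicities p)) (cong suc (sum-multiplicities p))

signed-empty : ∀ (c : Vec ℕ k) → sum c ≡ 0 → signed (replicate k 0) c 0 ≡ 1ℤ
signed-empty []         eq = refl
signed-empty (zero ∷ c) eq = trans (ℤ.*-identityˡ _) (signed-empty c eq)

-- Agreement of the count with the signed sum

∑-except : ∀ (f : Fin k → ℕ) b → ∑ℕ (λ a → if does (a ≟ b) then 0 else f a) ℕ.+ f b ≡ ∑ℕ f
∑-except f zero    = ℕ.+-comm _ (f zero)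
∑-except f (suc b) = trans (ℕ.+-assoc (f zero) _ _) (cong (f zero ℕ.+_) (∑-except (f ∘ suc) b))

pos-∑ : ∀ (f : Fin k → ℕ) → + ∑ℕ f ≡ ∑ℤ (λ a → + f a)
pos-∑ {zero}  f = refl
pos-∑ {suc k} f = cong (_+_ (+ f zero)) (pos-∑ (f ∘ suc))

-- Both sides obey the same recurrence: `signed-first` sums over all first letters, and
-- `signed-insert` takes away the forbidden one.
arrangements≡signed : ∀ (p : Vec (Fin k) n) c → n ≡ sum c →
                      + arrangements p c ≡ signed (multiplicities p) c 0
arrangements≡signed []      c 0≡sum = sym (signed-empty c (sym 0≡sum))
arrangements≡signed {k} {suc n} (b ∷ p) c n≡sum = begin
  + arrangements (b ∷ p) c
    ≡⟨ cancel (+ arrangements (b ∷ p) c) (+ g b) ⟩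
  + (arrangements (b ∷ p) c ℕ.+ g b) - + g b
    ≡⟨ cong (λ m → + m - + g b) (∑-except g b) ⟩
  + ∑ℕ g - + g b
    ≡⟨ cong₂ _-_ (trans (pos-∑ g) (sum-cong-≗ g≡∂)) (g≡∂ b) ⟩
  ∑∂ s c - ∂ b s c
    -- At `t = 0` no further object can come first, so the `lower` term is zero.
    ≡⟨ cong (_- ∂ b s c) (trans (signed-first (multiplicities p) c 0 bound) (ℤ.+-identityʳ (∑∂ s c))) ⟨
  s c - ∂ b s c
    ≡⟨ signed-insert b (multiplicities p) c 0 ⟨
  signed (multiplicities (b ∷ p)) c 0 ∎
  where
  open ≡-Reasoning

  g : Fin k → ℕ
  g a = maybe′ (arrangements p) 0 (remove a c)

  s : Vec ℕ k → ℤ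
  s c = signed (multiplicities p) c 0

  cancel : ∀ u v → u ≡ u + v - v
  cancel = solve-∀

  bound : sum (multiplicities p) < sum c
  bound = subst₂ _<_ (sym (sum-multiplicities p)) n≡sum (ℕ.n<1+n n)

  g≡∂ : ∀ a → + g a ≡ ∂ a s c
  g≡∂ a with remove a c in eq
  ... | nothing = refl
  ... | just c′ = arrangements≡signed p c′ (ℕ.suc-injective (trans n≡sum (remove-sum a c eq)))

-- Evaluation

memo : List ℤ → (ℕ → ℤ) → ℕ → ℤ
memo []       f t       = f t
memo (v ∷ vs) f zero    = v
memo (v ∷ vs) f (suc t) = memo vs (f ∘ suc) t

-- Beyond the table `memo` falls back to `f` itself, so the equation holds at every argument.
memo-applyUpTo : ∀ {f g : ℕ → ℤ} → g ≗ f → ∀ n → memo (applyUpTo g n) f ≗ f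
memo-applyUpTo g≗f zero    t       = refl
memo-applyUpTo g≗f (suc n) zero    = g≗f zero
memo-applyUpTo g≗f (suc n) (suc t) = memo-applyUpTo (g≗f ∘ suc) n t

uniform : ℕ → ℕ → ℕ → ℤ
uniform a k = signed (replicate k a) (replicate k a)

-- An entry at `t ≤ j * a` consults the previous row at `t + z` with `z ≤ a`, so that row has to
-- reach `suc j * a`.
nextRow : ℕ → ℕ → List ℤ → ℕ → ℤ
nextRow a k vs t = diff a (shuffle (memo vs (uniform a k)) t) a

-- row a k j holds the values of uniform a k at 0, …, j a.  The list vs of nextRow
-- being an argument, each entry of the previous row is evaluated only once.
row : ℕ → ℕ → ℕ → List ℤ
row a zero    j = []
row a (suc k) j = applyUpTo (nextRow a k (row a k (suc j))) (suc (j ℕ.* a))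

memo-row : ∀ a k j → memo (row a k j) (uniform a k) ≗ uniform a k
memo-row a zero    j t = refl
memo-row a (suc k) j =
  memo-applyUpTo (λ t → diff-cong a (λ z → cong (+ ((t ℕ.+ z) C z) *_) (memo-row a k (suc j) (t ℕ.+ z))) a)
                 (suc (j ℕ.* a))

arrangements-uniform : ∀ a (p : Vec (Fin k) n) → multiplicities p ≡ replicate k a →
                       arrangements p (replicate k a) ≡ ∣ memo (row a k 0) (uniform a k) 0 ∣
arrangements-uniform {k} {n} a p eq = cong ∣_∣ (begin
  + arrangements p (replicate k a)
    ≡⟨ arrangements≡signed p (replicate k a) (trans (sym (sum-multiplicities p)) (cong sum eq)) ⟩
  signed (multiplicities p) (replicate k a) 0
    ≡⟨ cong (λ r → signed r (replicate k a) 0) eq ⟩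
  uniform a k 0
    ≡⟨ memo-row a k 0 0 ⟨
  memo (row a k 0) (uniform a k) 0 ∎)
  where open ≡-Reasoning

arrangements-w : arrangements w (replicate 13 4) ≡ 1493804444499093354916284290188948031229880469556
-- Here `refl` computes that each letter is forbidden at exactly four positions.
arrangements-w = trans (arrangements-uniform 4 w refl) evaluation
  where
  evaluation : ∣ memo (row 4 13 0) (uniform 4 13) 0 ∣ ≡ 1493804444499093354916284290188948031229880469556
  -- Thirteen rows are computed, the longest with 49 entries and the last with one.
  evaluation = refl

mainTheorem1 : Derangement ↔ Fin 1493804444499093354916284290188948031229880469556
mainTheorem1 =
  subst (λ m → Derangement ↔ Fin m) arrangements-w
    (arrangements-↔ w (replicate 13 4) refl ↔-∘
     refine-↔ (λ P → (λ a → trans (proj₁ P a) (sym (lookup-replicate a 4))) , proj₂ P)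
              (λ P → (λ a → trans (proj₁ P a) (lookup-replicate a 4)) , proj₂ P))
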